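{- Let $G$ be an edge-coloured graph with $m$ edges and let $k$ be a positive integer. There is a vertex colouring of $G$ that produces at least $k$ stable edges if and only if $G$ contains a set $E'$ of at most $m-k$ edges such that $G-E'$ has no conflict pair.
   Context: An edge-coloured graph $G$ is a finite simple undirected graph in which each edge $e$ has a unique colour $\psi(e)\in\{1,\dots,t\}$ for some positive integer $t$ (not required to be a proper edge colouring). A vertex colouring $f$ of $G$ assigns to each vertex $v$ a colour $f(v)\in\{1,\dots,t\}$ (not required to be proper). For a vertex colouring $f$, an edge $uv$ is stable if $\psi(uv)=f(u)=f(v)$, and unstable otherwise. A conflict pair is a pair of adjacent edges (two distinct edges sharing an end) of different colours. $G-E'$ is the graph obtained from $G$ by deleting the edges in $E'$ (keeping all vertices). -}

module Defs where

open import Data.Bool using (true; false; if_then_else_)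
open import Data.Bool.Properties using (∨-comm)
open import Data.Fin using (Fin; _<_; _<?_)
open import Data.Fin.Properties using (_≟_)
open import Data.List using (List; length; filter; allFin; cartesianProduct)
open import Data.List.Membership.Propositional using (_∈_)
import Data.List.Membership.DecPropositional as DecMembership
open import Data.List.Relation.Binary.Subset.Propositional using (_⊆_)
open import Data.List.Relation.Unary.Unique.Propositional using (Unique)
open import Data.Maybe using (Maybe; just; nothing; Is-just)
open import Data.Maybe.Properties as Maybe using ()
open import Data.Maybe.Relation.Unary.Any using (dec)
open import Data.Nat using (ℕ)
open import Data.Product using (_×_; _,_; ∃; ∃₂)
open import Data.Product.Properties as Product using ()
open import Data.Sum using (_⊎_)
open import Data.Unit using (tt)
open import Relation.Binary.PropositionalEquality using (_≡_; _≢_; refl; cong₂)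
open import Relation.Nullary using (Dec; yes; no; does)
open import Relation.Nullary.Decidable using (_×-dec_; _⊎-dec_)
open import Relation.Unary using (Pred; Decidable)
open import Level using (0ℓ)

-- Edge-coloured simple graphs on the vertices Fin n with colours Fin t.
-- A single function carries both the adjacency and the edge colouring:
-- ψ u v is  just c  when uv is an edge of colour c, and  nothing  when u and v
-- are not adjacent.
record EdgeColouredGraph (n t : ℕ) : Set where
  field
    ψ        : Fin n → Fin n → Maybe (Fin t)
    ψ-sym    : ∀ u v → ψ u v ≡ ψ v u
    ψ-irrefl : ∀ v → ψ v v ≡ nothing

open EdgeColouredGraph public

-- The unordered pair {u , v} is represented by (u , v) with u < v; this
-- orientation is enforced by IsEdge below.
Pair : ℕ → Set
Pair n = Fin n × Fin n

private
  variable
    n t : ℕ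

IsEdge : EdgeColouredGraph n t → Pred (Pair n) 0ℓ
IsEdge G (u , v) = u < v × Is-just (ψ G u v)

isEdge? : (G : EdgeColouredGraph n t) → Decidable (IsEdge G)
isEdge? G (u , v) = u <? v ×-dec dec (λ _ → yes tt) (ψ G u v)

edges : EdgeColouredGraph n t → List (Pair n)
edges {n = n} G = filter (isEdge? G) (cartesianProduct (allFin n) (allFin n))

∥_∥ : EdgeColouredGraph n t → ℕ
∥ G ∥ = length (edges G)

VertexColouring : ℕ → ℕ → Set
VertexColouring n t = Fin n → Fin t

Stable : EdgeColouredGraph n t → VertexColouring n t → Pred (Pair n) 0ℓ
Stable G f (u , v) = ψ G u v ≡ just (f u) × ψ G u v ≡ just (f v)

stable? : (G : EdgeColouredGraph n t) (f : VertexColouring n t) → Decidable (Stable G f)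
stable? G f (u , v) =
  Maybe.≡-dec _≟_ (ψ G u v) (just (f u)) ×-dec Maybe.≡-dec _≟_ (ψ G u v) (just (f v))

#stable : EdgeColouredGraph n t → VertexColouring n t → ℕ
#stable G f = length (filter (stable? G f) (edges G))

_isEndOf_ : Fin n → Pair n → Set
w isEndOf (u , v) = w ≡ u ⊎ w ≡ v

-- On edges the value is always of the form  just c .
colour : EdgeColouredGraph n t → Pair n → Maybe (Fin t)
colour G (u , v) = ψ G u v

record ConflictPair (G : EdgeColouredGraph n t) (e e′ : Pair n) : Set where
  field
    edgeˡ     : IsEdge G e
    edgeʳ     : IsEdge G e′
    distinct  : e ≢ e′
    adjacent  : ∃ λ w → w isEndOf e × w isEndOf e′
    different : colour G e ≢ colour G e′

HasConflictPair : EdgeColouredGraph n t → Set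
HasConflictPair G = ∃₂ (ConflictPair G)

record EdgeSet (G : EdgeColouredGraph n t) : Set where
  field
    elements : List (Pair n)
    unique   : Unique elements
    isSubset : elements ⊆ edges G

open EdgeSet public

∣_∣ : {G : EdgeColouredGraph n t} → EdgeSet G → ℕ
∣ E′ ∣ = length (elements E′)

Deleted : {G : EdgeColouredGraph n t} → EdgeSet G → Fin n → Fin n → Set
Deleted E′ u v = (u , v) ∈ elements E′ ⊎ (v , u) ∈ elements E′

_∈ₚ?_ : (e : Pair n) (es : List (Pair n)) → Dec (e ∈ es)
_∈ₚ?_ = DecMembership._∈?_ (Product.≡-dec _≟_ _≟_)

deleted? : {G : EdgeColouredGraph n t} (E′ : EdgeSet G) (u v : Fin n) → Dec (Deleted E′ u v)
deleted? E′ u v = ((u , v) ∈ₚ? elements E′) ⊎-dec ((v , u) ∈ₚ? elements E′)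

infixl 6 _─_

_─_ : (G : EdgeColouredGraph n t) → EdgeSet G → EdgeColouredGraph n t
ψ (G ─ E′) u v = if does (deleted? E′ u v) then nothing else ψ G u v
ψ-sym (G ─ E′) u v = cong₂ (λ b c → if b then nothing else c)
  (∨-comm (does ((u , v) ∈ₚ? elements E′)) (does ((v , u) ∈ₚ? elements E′)))
  (ψ-sym G u v)
ψ-irrefl (G ─ E′) v with does (deleted? E′ v v)
... | true  = refl
... | false = ψ-irrefl G v

{-# OPTIONS --safe #-}

-- Adjacent stable edges both carry the colour of a common end, so deleting the
-- unstable edges leaves no conflict pair.  Conversely, if G − E′ has no conflict
-- pair, then all its edges at a vertex v share one colour; giving v that colour
-- makes every edge outside E′ stable.

module Submission where

open import Defs
open import Data.Bool using (if_then_else_)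
open import Data.Fin using (Fin; fromℕ<)
open import Data.Fin.Properties using (_≟_; <-cmp; <-asym; any?; injective⇒≤)
open import Data.Integer using (+_; _-_; -_; +≤+) renaming (_≤_ to _≤ᶻ_)
import Data.Integer as ℤ
import Data.Integer.Properties as ℤ
open import Data.List using (List; []; _∷_; _++_; length; filter; lookup; allFin; cartesianProduct)
open import Data.List.Membership.Propositional using (_∈_)
open import Data.List.Membership.Propositional.Properties
  using (∈-lookup; ∈-filter⁺; ∈-filter⁻; ∈-allFin; ∈-cartesianProduct⁺; ∈-++⁺ˡ; ∈-++⁺ʳ)
open import Data.List.Membership.Setoid.Properties using (index-injective)
open import Data.List.Properties using (length-++)
open import Data.List.Relation.Binary.Subset.Propositional using (_⊆_)
open import Data.List.Relation.Binary.Subset.Propositional.Properties using (filter-⊆)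
import Data.List.Relation.Unary.All as All
open import Data.List.Relation.Unary.AllPairs using (_∷_)
open import Data.List.Relation.Unary.Any using (index)
open import Data.List.Relation.Unary.Unique.Propositional using (Unique)
open import Data.List.Relation.Unary.Unique.Propositional.Properties
  using (allFin⁺; cartesianProduct⁺; filter⁺)
open import Data.Maybe using (Maybe; just; nothing)
open import Data.Maybe.Properties as Maybe using (just-injective)
import Data.Maybe.Relation.Unary.Any as MaybeAny
open import Data.Nat using (ℕ; suc; _+_; _≤_; _≥_; NonZero; >-nonZero⁻¹)
open import Data.Nat.Properties using (+-suc; +-monoʳ-≤; +-cancelˡ-≤; ≤-trans; ≤-reflexive)
open import Data.Product using (∃; _×_; _,_; proj₁; proj₂)
open import Data.Sum using (inj₁; inj₂; [_,_]′)
open import Data.Unit using (tt)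
open import Function using (_∘_)
open import Function.Bundles using (_⇔_; mk⇔; module Equivalence)
open import Function.Definitions using (Injective)
open import Level using (0ℓ)
open import Relation.Binary.Definitions using (tri<; tri≈; tri>)
open import Relation.Binary.PropositionalEquality
  using (_≡_; refl; sym; trans; cong; subst; setoid)
open import Relation.Nullary using (¬_; Dec; yes; no; does; contradiction)
open import Relation.Nullary.Decidable using (¬?; dec-false; decidable-stable)
open import Relation.Unary using (Pred; Decidable)

private
  variable
    n t : ℕ
    A B : Set

lookup-injective : {xs : List A} → Unique xs → Injective _≡_ _≡_ (lookup xs)
lookup-injective {xs = _ ∷ _} _          {Fin.zero}  {Fin.zero}  _  = refl
lookup-injective {xs = _ ∷ _} (x∉ ∷ _)   {Fin.zero}  {Fin.suc j} eq =
  contradiction eq (All.lookup x∉ (∈-lookup j))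
lookup-injective {xs = _ ∷ _} (x∉ ∷ _)   {Fin.suc i} {Fin.zero}  eq =
  contradiction (sym eq) (All.lookup x∉ (∈-lookup i))
lookup-injective {xs = _ ∷ _} (_  ∷ xs!) {Fin.suc i} {Fin.suc j} eq =
  cong Fin.suc (lookup-injective xs! eq)

-- Pigeonhole: sending each position of `xs` to a position of the same entry in `ys` is injective,
-- because `xs` has no repetitions.
unique-⊆⇒length≤ : {xs ys : List A} → Unique xs → xs ⊆ ys → length xs ≤ length ys
unique-⊆⇒length≤ xs! xs⊆ys = injective⇒≤
  {f = λ i → index (xs⊆ys (∈-lookup i))}
  (lookup-injective xs! ∘ index-injective (setoid _) _ _)

length-filter-∁ : {P : Pred A 0ℓ} (P? : Decidable P) (xs : List A) →
  length (filter (¬? ∘ P?) xs) + length (filter P? xs) ≡ length xs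
length-filter-∁ P? []       = refl
length-filter-∁ P? (x ∷ xs) with P? x
... | yes _ = trans (+-suc _ _) (cong suc (length-filter-∁ P? xs))
... | no  _ = cong suc (length-filter-∁ P? xs)

-- Bridges the integer bound of the theorem and the counting below, done in `ℕ`. In the integers,
-- `m - k` is negative when `k` exceeds `m`; truncated subtraction would give zero and admit an
-- empty edge set.
+-≤⇔≤- : ∀ a k m → a + k ≤ m ⇔ (+ a ≤ᶻ + m - + k)
+-≤⇔≤- a k m = mk⇔ to from
  where
  to : a + k ≤ m → + a ≤ᶻ + m - + k
  to a+k≤m = subst (_≤ᶻ + m - + k) cancel (ℤ.+-monoˡ-≤ (- + k) (+≤+ a+k≤m))
    where
    cancel : + a ℤ.+ + k - + k ≡ + a
    cancel = trans (ℤ.+-assoc (+ a) (+ k) (- + k))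
      (trans (cong (λ i → + a ℤ.+ i) (ℤ.+-inverseʳ (+ k))) (ℤ.+-identityʳ (+ a)))
  from : + a ≤ᶻ + m - + k → a + k ≤ m
  from a≤m-k = ℤ.drop‿+≤+ (subst (+ (a + k) ≤ᶻ_) cancel (ℤ.+-monoˡ-≤ (+ k) a≤m-k))
    where
    cancel : + m - + k ℤ.+ + k ≡ + m
    cancel = trans (ℤ.+-assoc (+ m) (- + k) (+ k))
      (trans (cong (λ i → + m ℤ.+ i) (ℤ.+-inverseˡ (+ k))) (ℤ.+-identityʳ (+ m)))

edges-unique : (G : EdgeColouredGraph n t) → Unique (edges G)
edges-unique {n = n} G = filter⁺ (isEdge? G) (cartesianProduct⁺ (allFin⁺ n) (allFin⁺ n))

∈-edges⁺ : (G : EdgeColouredGraph n t) {e : Pair n} → IsEdge G e → e ∈ edges G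
∈-edges⁺ G = ∈-filter⁺ (isEdge? G) (∈-cartesianProduct⁺ (∈-allFin _) (∈-allFin _))

∈-edges⁻ : (G : EdgeColouredGraph n t) {e : Pair n} → e ∈ edges G → IsEdge G e
∈-edges⁻ {n = n} G e∈ = proj₂ (∈-filter⁻ (isEdge? G) {xs = cartesianProduct (allFin n) (allFin n)} e∈)

edge-colour : (G : EdgeColouredGraph n t) {e : Pair n} → IsEdge G e → ∃ λ c → colour G e ≡ just c
edge-colour G {u , v} (_ , p) with just c ← ψ G u v = c , refl

-- `ψ` accepts both orders of the ends while `IsEdge` demands the increasing one, so the edge is
-- whichever of `(u , v)` and `(v , u)` is increasing; the diagonal carries no colour.
colour⇒edge : (G : EdgeColouredGraph n t) {u v : Fin n} {c : Fin t} → ψ G u v ≡ just c →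
  ∃ λ e → IsEdge G e × colour G e ≡ just c × u isEndOf e
colour⇒edge G {u} {v} eq with <-cmp u v
... | tri< u<v _ _  = (u , v) , (u<v , subst (MaybeAny.Any _) (sym eq) (MaybeAny.just tt)) , eq , inj₁ refl
... | tri≈ _ refl _ with () ← trans (sym eq) (ψ-irrefl G u)
... | tri> _ _ v<u  = (v , u) , (v<u , subst (MaybeAny.Any _) (sym eq′) (MaybeAny.just tt)) , eq′ , inj₂ refl
  where eq′ = trans (ψ-sym G v u) eq

conflict-free⇒≡ : (G : EdgeColouredGraph n t) → ¬ HasConflictPair G →
  ∀ {v w w′ c d} → ψ G v w ≡ just c → ψ G v w′ ≡ just d → c ≡ d
conflict-free⇒≡ G ok {v} {c = c} {d} eq eq′
  with colour⇒edge G eq | colour⇒edge G eq′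
... | e , isE , col , end | e′ , isE′ , col′ , end′ = decidable-stable (c ≟ d) λ c≢d →
  let different : ¬ (colour G e ≡ colour G e′)
      different same = c≢d (just-injective (trans (sym col) (trans same col′)))
  in ok (e , e′ , record
    { edgeˡ     = isE
    ; edgeʳ     = isE′
    -- Equal edges would have equal colours, so distinctness comes for free.
    ; distinct  = different ∘ cong (colour G)
    ; adjacent  = v , end , end′
    ; different = different
    })

-- A finite search over neighbours and colours decides whether `v` meets an edge. The colour of any
-- edge found is then shared by all edges at `v`.
vertex-colour : .{{_ : NonZero t}} (G : EdgeColouredGraph n t) → ¬ HasConflictPair G →
  ∀ v → ∃ λ c → ∀ {w d} → ψ G v w ≡ just d → d ≡ c
vertex-colour {t = t} G ok v
  with any? (λ w → any? (λ c → Maybe.≡-dec _≟_ (ψ G v w) (just c)))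
... | yes (_ , c , eq) = c , λ eq′ → conflict-free⇒≡ G ok eq′ eq
-- At an isolated vertex the condition is vacuous and any colour will do; `NonZero t` provides
-- colour zero.
... | no ¬edge         = fromℕ< (>-nonZero⁻¹ t) , λ eq → contradiction (_ , _ , eq) ¬edge

conflict-free⇒stable : .{{_ : NonZero t}} (G : EdgeColouredGraph n t) → ¬ HasConflictPair G →
  ∃ λ f → ∀ {u v c} → ψ G u v ≡ just c → Stable G f (u , v)
conflict-free⇒stable G ok = f , λ {u} {v} eq →
    trans eq (cong just (proj₂ (vertex-colour G ok u) eq))
  , trans eq (cong just (proj₂ (vertex-colour G ok v) (trans (ψ-sym G v u) eq)))
  where
  f = proj₁ ∘ vertex-colour G ok

-- Two stable edges that meet at `w` both have colour `f w`.
all-stable⇒conflict-free : (G : EdgeColouredGraph n t) (f : VertexColouring n t) →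
  (∀ {e} → IsEdge G e → Stable G f e) → ¬ HasConflictPair G
all-stable⇒conflict-free G f stable (e , e′ , conflict) with ConflictPair.adjacent conflict
... | w , end , end′ = ConflictPair.different conflict
  (trans (at-end (stable (ConflictPair.edgeˡ conflict)) end)
    (sym (at-end (stable (ConflictPair.edgeʳ conflict)) end′)))
  where
  at-end : ∀ {e w} → Stable G f e → w isEndOf e → colour G e ≡ just (f w)
  at-end (l , _) (inj₁ refl) = l
  at-end (_ , r) (inj₂ refl) = r

-- Stated for an arbitrary decision, so that matching on it reduces the `if`; a `yes` would make
-- `nothing` equal to `just b`.
if-nothing⁻ : (a? : Dec A) {m : Maybe B} {b : B} →
  (if does a? then nothing else m) ≡ just b → ¬ A × m ≡ just b
if-nothing⁻ (no ¬a) eq = ¬a , eq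

module _ {G : EdgeColouredGraph n t} (E′ : EdgeSet G) where

  ─-colour⁻ : ∀ {u v c} → ψ (G ─ E′) u v ≡ just c → ¬ Deleted E′ u v × ψ G u v ≡ just c
  ─-colour⁻ {u} {v} = if-nothing⁻ (deleted? E′ u v)

  ─-edge⁻ : ∀ {e} → IsEdge (G ─ E′) e → ¬ (e ∈ elements E′) × IsEdge G e
  ─-edge⁻ isE@(u<v , _) with edge-colour (G ─ E′) isE
  ... | _ , eq with ─-colour⁻ eq
  ...   | ¬del , eq′ = ¬del ∘ inj₁ , u<v , subst (MaybeAny.Any _) (sym eq′) (MaybeAny.just tt)

  ─-colour⁺ : ∀ {e} → IsEdge G e → ¬ (e ∈ elements E′) → colour (G ─ E′) e ≡ colour G e
  ─-colour⁺ {u , v} (u<v , _) e∉ =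
    cong (if_then nothing else ψ G u v) (dec-false (deleted? E′ u v) ¬del)
    where
    ¬del : ¬ Deleted E′ u v
    -- `Deleted` also tests the reversed pair, which cannot lie in `E′`: members of `E′` are edges
    -- of `G` and hence increasing.
    ¬del = [ e∉ , (λ vu∈ → <-asym u<v (proj₁ (∈-edges⁻ G (isSubset E′ vu∈)))) ]′

unstableEdges : (G : EdgeColouredGraph n t) → VertexColouring n t → EdgeSet G
unstableEdges G f = record
  { elements = filter (¬? ∘ stable? G f) (edges G)
  ; unique   = filter⁺ (¬? ∘ stable? G f) (edges-unique G)
  ; isSubset = filter-⊆ (¬? ∘ stable? G f) (edges G)
  }

─-unstable-conflict-free : (G : EdgeColouredGraph n t) (f : VertexColouring n t) →
  ¬ HasConflictPair (G ─ unstableEdges G f)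
─-unstable-conflict-free G f = all-stable⇒conflict-free (G ─ E′) f stable
  where
  E′ = unstableEdges G f
  stable : ∀ {e} → IsEdge (G ─ E′) e → Stable (G ─ E′) f e
  stable {e} isE with ─-edge⁻ E′ isE
  -- Escaping the list of unstable edges only refutes instability; decidability of `Stable` turns
  -- this into stability in `G`, and a surviving edge keeps its colour.
  ... | e∉ , isE-G with decidable-stable (stable? G f e)
                          (e∉ ∘ ∈-filter⁺ (¬? ∘ stable? G f) (∈-edges⁺ G isE-G))
  ...   | l , r = trans (─-colour⁺ E′ isE-G e∉) l , trans (─-colour⁺ E′ isE-G e∉) r

-- Every edge of `G` is in `E′` or survives and is stable, so the concatenation of `E′` with the
-- stable edges covers the duplicate-free list `edges G`.
∥∥≤deleted+stable : (G : EdgeColouredGraph n t) (E′ : EdgeSet G) (f : VertexColouring n t) →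
  (∀ {u v c} → ψ (G ─ E′) u v ≡ just c → Stable (G ─ E′) f (u , v)) →
  ∥ G ∥ ≤ ∣ E′ ∣ + #stable G f
∥∥≤deleted+stable G E′ f stable = ≤-trans (unique-⊆⇒length≤ (edges-unique G) covered)
  (≤-reflexive (length-++ (elements E′)))
  where
  covered : edges G ⊆ elements E′ ++ filter (stable? G f) (edges G)
  covered {e} e∈ with e ∈ₚ? elements E′
  ... | yes e∈E′ = ∈-++⁺ˡ e∈E′
  ... | no  e∉E′ with edge-colour G (∈-edges⁻ G e∈)
  -- Stability is known in `G ─ E′`; each colour present there is also the colour in `G`, so it
  -- carries back.
  ...   | _ , eq with stable (trans (─-colour⁺ E′ (∈-edges⁻ G e∈) e∉E′) eq)
  ...     | l , r = ∈-++⁺ʳ (elements E′)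
    (∈-filter⁺ (stable? G f) e∈ (proj₂ (─-colour⁻ E′ l) , proj₂ (─-colour⁻ E′ r)))

corollary3p2 : ∀ {n t : ℕ} .{{_ : NonZero t}} (G : EdgeColouredGraph n t) (k : ℕ) .{{_ : NonZero k}} →
    (∃ λ (f : VertexColouring n t) → #stable G f ≥ k) ⇔
    (∃ λ (E′ : EdgeSet G) → (+ ∣ E′ ∣ ≤ᶻ + ∥ G ∥ - + k) × ¬ HasConflictPair (G ─ E′))
corollary3p2 {n} {t} G k = mk⇔ to from
  where
  open Equivalence renaming (to to ⇒; from to ⇐)

  to : (∃ λ (f : VertexColouring n t) → #stable G f ≥ k) →
       ∃ λ (E′ : EdgeSet G) → (+ ∣ E′ ∣ ≤ᶻ + ∥ G ∥ - + k) × ¬ HasConflictPair (G ─ E′)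
  to (f , k≤) = E′ , ⇒ (+-≤⇔≤- ∣ E′ ∣ k ∥ G ∥) bound , ─-unstable-conflict-free G f
    where
    E′ = unstableEdges G f
    bound : ∣ E′ ∣ + k ≤ ∥ G ∥
    -- The unstable and the stable edges together number exactly `∥ G ∥`.
    bound = ≤-trans (+-monoʳ-≤ ∣ E′ ∣ k≤) (≤-reflexive (length-filter-∁ (stable? G f) (edges G)))

  from : (∃ λ (E′ : EdgeSet G) → (+ ∣ E′ ∣ ≤ᶻ + ∥ G ∥ - + k) × ¬ HasConflictPair (G ─ E′)) →
         ∃ λ (f : VertexColouring n t) → #stable G f ≥ k
  from (E′ , bound , ok) with conflict-free⇒stable (G ─ E′) ok
  -- Cancel `∣ E′ ∣` in `∣ E′ ∣ + k ≤ ∥ G ∥ ≤ ∣ E′ ∣ + #stable G f`.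
  ... | f , stable = f , +-cancelˡ-≤ ∣ E′ ∣ k (#stable G f)
    (≤-trans (⇐ (+-≤⇔≤- ∣ E′ ∣ k ∥ G ∥) bound) (∥∥≤deleted+stable G E′ f stable))
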